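{- Let $n \geq 4$ be an integer. Then the square $Q_n^2$ of the hypercube $Q_n$ is an imprimitive distance-transitive graph if and only if $n$ is an odd integer.
   Context: All graphs are finite, simple and undirected. The hypercube $Q_n$ is the graph with vertex set $\{0,1\}^n$ in which two $n$-tuples are adjacent if and only if they differ in precisely one coordinate. For a graph $\Gamma=(V,E)$, the square $\Gamma^2$ is the simple graph with vertex set $V$ in which two distinct vertices are adjacent if and only if their distance in $\Gamma$ is at most two. A graph $\Gamma$ is distance-transitive if for all vertices $u,v,x,y$ of $\Gamma$ with $d(u,v)=d(x,y)$ (graph distance in $\Gamma$) there is an automorphism $\pi$ of $\Gamma$ such that $\pi(u)=x$ and $\pi(v)=y$. A block in the action of a group $G$ on a set $X$ is a subset $B\subseteq X$ such that $B\cap g(B)\in\{B,\emptyset\}$ for each $g\in G$. If $G$ is transitive on $X$, the permutation group $(X,G)$ is primitive if the only blocks are the trivial ones, that is, those of cardinality $0$, $1$ or $|X|$; otherwise it is imprimitive. A graph $\Gamma$ is primitive (respectively imprimitive) if the group $\mathrm{Aut}(\Gamma)$ acting on $V(\Gamma)$ is primitive (respectively imprimitive). -}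

module Defs where

open import Data.Bool using (Bool; T)
open import Data.Bool.Properties using () renaming (_≟_ to _≟ᵇ_)
open import Data.Fin using (Fin)
open import Data.Fin.Properties using (any?; all?; *↔×; 1↔⊤; 2↔Bool)
  renaming (_≟_ to _≟ᶠ_)
open import Data.Nat using (ℕ; zero; suc; _≤_; _<_; s≤s; s≤s⁻¹; _^_)
open import Data.Nat.Properties using (anyUpTo?; allUpTo?)
open import Data.Nat.Divisibility using (_∣_)
open import Data.Product using (Σ; ∃; ∃!; _×_; _,_; proj₁; proj₂)
open import Data.Product.Function.NonDependent.Propositional using (_×-↔_)
open import Data.Sum using (_⊎_)
open import Data.Vec using (Vec; []; _∷_; lookup)
open import Data.Unit using (tt)
open import Function.Base using (_∘_)
open import Function.Bundles using (_↔_; _⇔_; Inverse; Equivalence; mk↔ₛ′; mk⇔)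
open import Function.Construct.Composition using (_↔-∘_; _⇔-∘_)
open import Function.Construct.Identity using (↔-id; ⇔-id)
open import Function.Construct.Symmetry using (↔-sym; ⇔-sym)
open import Function.Properties.Inverse using (Inverse⇒Injection)
open import Level using (0ℓ)
open import Relation.Binary using (Decidable; Symmetric; Irreflexive; DecidableEquality)
open import Relation.Binary.PropositionalEquality
  using (_≡_; _≢_; refl; sym; subst; subst₂; cong)
open import Relation.Nullary using (¬_; Dec)
open import Relation.Nullary.Decidable
  using (map′; ¬?; _×-dec_; _→-dec_; via-injection)
open import Relation.Unary using (Pred; _∩_; _≐_; Empty)
import Relation.Unary as U

-- Vertices are finite and adjacency is decidable, so the classical and
-- constructive readings of the notions below agree.
record Graph : Set₁ where
  field
    Vertex    : Set
    order     : ℕ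
    enumerate : Vertex ↔ Fin order
    _~_       : Vertex → Vertex → Set
    ~-sym     : Symmetric _~_
    ~-irrefl  : Irreflexive _≡_ _~_
    _~?_      : Decidable _~_

module _ (Γ : Graph) where
  open Graph Γ

  data Walk : Vertex → Vertex → ℕ → Set where
    []  : ∀ {u} → Walk u u 0
    _∷_ : ∀ {u v w k} → u ~ v → Walk v w k → Walk u w (suc k)

  -- "d(u,v) = d"; no d qualifies when u and v lie in different components.
  IsDistance : Vertex → Vertex → ℕ → Set
  IsDistance u v d = Walk u v d × (∀ {k} → k < d → ¬ Walk u v k)

  -- "d(u,v) = d(x,y)", as an equality in ℕ ∪ {∞}.
  SameDistance : (u v x y : Vertex) → Set
  SameDistance u v x y = ∀ d → IsDistance u v d ⇔ IsDistance x y d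

  IsAutomorphism : Vertex ↔ Vertex → Set
  IsAutomorphism π = ∀ u v → (u ~ v) ⇔ (Inverse.to π u ~ Inverse.to π v)

  DistanceTransitive : Set
  DistanceTransitive = ∀ u v x y → SameDistance u v x y →
    ∃ λ π → IsAutomorphism π × Inverse.to π u ≡ x × Inverse.to π v ≡ y

  _≟ⱽ_ : DecidableEquality Vertex
  _≟ⱽ_ = via-injection (Inverse⇒Injection enumerate) _≟ᶠ_

  anyVertex? : {P : Pred Vertex 0ℓ} → U.Decidable P → Dec (∃ P)
  anyVertex? {P} P? = map′
    (λ (i , p) → Inverse.from enumerate i , p)
    (λ (v , p) → Inverse.to enumerate v
               , subst P (sym (Inverse.strictlyInverseʳ enumerate v)) p)
    (any? (λ i → P? (Inverse.from enumerate i)))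

  walk? : ∀ u v k → Dec (Walk u v k)
  walk? u v zero = map′ (λ { refl → [] }) (λ { [] → refl }) (u ≟ⱽ v)
  walk? u w (suc k) = map′
    (λ (_ , e , p) → e ∷ p) (λ { (e ∷ p) → _ , e , p })
    (anyVertex? (λ v → (u ~? v) ×-dec walk? v w k))

  isDistance? : ∀ u v d → Dec (IsDistance u v d)
  isDistance? u v d =
    walk? u v d ×-dec allUpTo? (λ k → ¬? (walk? u v k)) d

  snoc : ∀ {u v w k} → Walk u v k → v ~ w → Walk u w (suc k)
  snoc []      e = e ∷ []
  snoc (f ∷ p) e = f ∷ snoc p e

  reverse : ∀ {u v k} → Walk u v k → Walk v u k
  reverse []      = []
  reverse (e ∷ p) = snoc (reverse p) (~-sym e)

  isDistance-sym : ∀ {u v d} → IsDistance u v d → IsDistance v u d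
  isDistance-sym (p , min) = reverse p , λ k<d q → min k<d (reverse q)

  square : Graph
  square = record
    { Vertex    = Vertex
    ; order     = order
    ; enumerate = enumerate
    ; _~_       = λ u v → u ≢ v × ∃ λ d → d ≤ 2 × IsDistance u v d
    ; ~-sym     = λ (u≢v , d , d≤2 , p) →
                    u≢v ∘ sym , d , d≤2 , isDistance-sym p
    ; ~-irrefl  = λ u≡v (u≢v , _) → u≢v u≡v
    ; _~?_      = λ u v → ¬? (u ≟ⱽ v) ×-dec map′
                    (λ (d , d<3 , p) → d , s≤s⁻¹ d<3 , p)
                    (λ (d , d≤2 , p) → d , s≤s d≤2 , p)
                    (anyUpTo? (isDistance? u v) 3)
    }

record PermutationGroup (X : Set) : Set₁ where
  field
    Member    : X ↔ X → Set
    id-closed : Member (↔-id X)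
    ∘-closed  : ∀ {g h} → Member g → Member h → Member (g ↔-∘ h)
    ⁻¹-closed : ∀ {g} → Member g → Member (↔-sym g)

-- Decidable subsets, which on a finite set are all the classical ones.
Subset : Set → Set
Subset X = X → Bool

module _ {X : Set} where

  ⟦_⟧ : Subset X → Pred X 0ℓ
  ⟦ B ⟧ x = T (B x)

  -- T (B x) has at most one proof, so Elements B has exactly one
  -- inhabitant for each element of B.
  Elements : Subset X → Set
  Elements B = Σ X ⟦ B ⟧

  image : X ↔ X → Subset X → Pred X 0ℓ
  image g B y = ∃ λ x → T (B x) × Inverse.to g x ≡ y

  -- |B| ∈ {0 , 1 , |X|}
  IsTrivial : Subset X → Set
  IsTrivial B = (Elements B ↔ Fin 0) ⊎ (Elements B ↔ Fin 1) ⊎ (Elements B ↔ X)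

  module _ (G : PermutationGroup X) where
    open PermutationGroup G

    IsTransitive : Set
    IsTransitive = ∀ x y → ∃ λ g → Member g × Inverse.to g x ≡ y

    IsBlock : Subset X → Set
    IsBlock B = ∀ g → Member g →
      ((⟦ B ⟧ ∩ image g B) ≐ ⟦ B ⟧) ⊎ Empty (⟦ B ⟧ ∩ image g B)

    IsPrimitive : Set
    IsPrimitive = IsTransitive × (∀ B → IsBlock B → IsTrivial B)

    IsImprimitive : Set
    IsImprimitive = IsTransitive × ¬ IsPrimitive

Aut : (Γ : Graph) → PermutationGroup (Graph.Vertex Γ)
Aut Γ = record
  { Member    = IsAutomorphism Γ
  ; id-closed = λ u v → ⇔-id (u ~ v)
  ; ∘-closed  = λ {_} {h} g-aut h-aut u v →
                  g-aut (Inverse.to h u) (Inverse.to h v) ⇔-∘ h-aut u v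
  ; ⁻¹-closed = λ {g} g-aut u v →
      let open Inverse g
          e = g-aut (from u) (from v)
      in mk⇔
        (λ p → Equivalence.from e (subst₂ _~_
                 (sym (strictlyInverseˡ u)) (sym (strictlyInverseˡ v)) p))
        (λ p → subst₂ _~_ (strictlyInverseˡ u) (strictlyInverseˡ v)
                 (Equivalence.to e p))
  }
  where open Graph Γ

Primitive Imprimitive : Graph → Set
Primitive   Γ = IsPrimitive (Aut Γ)
Imprimitive Γ = IsImprimitive (Aut Γ)

bitVectors↔ : ∀ n → Vec Bool n ↔ Fin (2 ^ n)
bitVectors↔ zero = ↔-sym 1↔⊤ ↔-∘
  mk↔ₛ′ (λ _ → tt) (λ _ → []) (λ _ → refl) (λ { [] → refl })
bitVectors↔ (suc n) =
  ↔-sym *↔× ↔-∘ ((↔-sym 2↔Bool ×-↔ bitVectors↔ n) ↔-∘ uncons↔)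
  where
  uncons↔ : Vec Bool (suc n) ↔ (Bool × Vec Bool n)
  uncons↔ = mk↔ₛ′ (λ { (b ∷ bs) → b , bs }) (λ (b , bs) → b ∷ bs)
    (λ _ → refl) (λ { (_ ∷ _) → refl })

DifferAt : ∀ {n} → Vec Bool n → Vec Bool n → Pred (Fin n) 0ℓ
DifferAt u v i = lookup u i ≢ lookup v i

differAt? : ∀ {n} (u v : Vec Bool n) → U.Decidable (DifferAt u v)
differAt? u v i = ¬? (lookup u i ≟ᵇ lookup v i)

Q : ℕ → Graph
Q n = record
  { Vertex    = Vec Bool n
  ; order     = 2 ^ n
  ; enumerate = bitVectors↔ n
  ; _~_       = λ u v → ∃! _≡_ (DifferAt u v)
  ; ~-sym     = λ (i , d , unique) → i , d ∘ sym , λ d′ → unique (d′ ∘ sym)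
  ; ~-irrefl  = λ u≡v (i , d , _) → d (cong (λ w → lookup w i) u≡v)
  ; _~?_      = λ u v → any? λ i → differAt? u v i ×-dec map′
                  (λ h {j} → h j) (λ h j → h {j})
                  (all? λ j → differAt? u v j →-dec (i ≟ᶠ j))
  }

Odd : ℕ → Set
Odd n = ¬ (2 ∣ n)

{-# OPTIONS --safe #-}
module Submission where

-- The distance of u and v in the square of the n-cube is half the Hamming
-- distance of u and v, rounded up. Prefixing a parity bit turns the square into
-- the halved (n+1)-cube, on which all coordinate permutations of the (n+1)-cube
-- act; together with the translations they move any pair of vertices to any
-- other pair at the same distance. If n is even and a block contains two
-- vertices u and v at distance k, it contains the whole sphere of radius k
-- around each of its elements. As n + 1 is odd, 2k < n + 1, so the sphere around
-- u contains two adjacent vertices; hence the block is closed under adjacency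
-- and is everything. If n is odd, every vertex has exactly one vertex at maximal
-- distance (n + 1)/2, and these antipodal pairs are blocks.

open import Defs
open import Data.Bool using (Bool; true; false; not; T; _xor_)
open import Data.Bool.Properties
  using (xor-assoc; xor-comm; xor-same; xor-identityʳ; not-involutive; T-irrelevant; T?)
  renaming (_≟_ to _≟ᵇ_)
open import Data.Empty using (⊥; ⊥-elim)
open import Data.Fin using (Fin; zero; suc)
open import Data.Fin.Properties using (0≢1+n; suc-injective)
open import Data.Nat
  using (ℕ; zero; suc; pred; _+_; _*_; _≤_; z≤n; s≤s; ⌊_/2⌋; ⌈_/2⌉)
open import Data.Nat.Properties hiding (0≢1+n; suc-injective)
open import Data.Nat.Divisibility using (_∣_; divides)
open import Data.Product using (∃; _×_; _,_; proj₁; proj₂; -,_)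
open import Data.Sum using (_⊎_; inj₁; inj₂)
open import Data.Vec using (Vec; []; _∷_; lookup; zipWith; replicate; tail)
open import Data.Vec.Properties
  using (zipWith-assoc; zipWith-comm; zipWith-identityˡ; zipWith-identityʳ; ≡-dec)
open import Function.Base using (_∘_)
open import Function.Bundles using (_↔_; _⇔_; Inverse; Injection; Equivalence; mk↔ₛ′; mk⇔)
open import Function.Construct.Symmetry using (↔-sym)
open import Function.Properties.Inverse using (Inverse⇒Injection)
open import Relation.Binary.PropositionalEquality
open import Relation.Nullary using (¬_; Dec; yes; no; contradiction)
open import Relation.Nullary.Decidable
  using (toWitness; fromWitness; isYes; decidable-stable; ¬?; _×-dec_; _⊎-dec_)

-- Distances in squares

module _ {Γ : Graph} where
  open Graph Γ

  concat : ∀ {u v w j k} → Walk Γ u v j → Walk Γ v w k → Walk Γ u w (j + k)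
  concat []      q = q
  concat (e ∷ p) q = e ∷ concat p q

  isDistance-≤ : ∀ {u v d k} → IsDistance Γ u v d → Walk Γ u v k → d ≤ k
  isDistance-≤ (_ , min) q = ≮⇒≥ λ k<d → min k<d q

  isDistance-unique : ∀ {u v d e} → IsDistance Γ u v d → IsDistance Γ u v e → d ≡ e
  isDistance-unique p q = ≤-antisym (isDistance-≤ p (proj₁ q)) (isDistance-≤ q (proj₁ p))

  geodesicˡ : ∀ {u v w j k} → IsDistance Γ u w (j + k) →
              Walk Γ u v j → Walk Γ v w k → IsDistance Γ u v j
  geodesicˡ {k = k} (_ , min) p q = p , λ i<j r → min (+-monoˡ-< k i<j) (concat r q)

  geodesicʳ : ∀ {u v w j k} → IsDistance Γ u w (j + k) →
              Walk Γ u v j → Walk Γ v w k → IsDistance Γ v w k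
  geodesicʳ {j = j} (_ , min) p q = q , λ i<k r → min (+-monoʳ-< j i<k) (concat p r)

  square-edge : ∀ {u v d} → suc d ≤ 2 → IsDistance Γ u v (suc d) →
                Graph._~_ (square Γ) u v
  square-edge d≤2 p = (λ { refl → proj₂ p (s≤s z≤n) [] }) , -, d≤2 , p

  -- A geodesic is cut into pieces of length two. Each piece is again a geodesic, hence an edge of
  -- the square; an odd leftover edge accounts for the rounding up.
  square-geodesic : ∀ {u v d} → Walk Γ u v d → IsDistance Γ u v d →
                    Walk (square Γ) u v ⌈ d /2⌉
  square-geodesic []          _ = []
  square-geodesic (e ∷ [])    g = square-edge (s≤s z≤n) g ∷ []
  square-geodesic (e ∷ f ∷ p) g =
    square-edge ≤-refl (geodesicˡ g (e ∷ f ∷ []) p)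
    ∷ square-geodesic p (geodesicʳ g (e ∷ f ∷ []) p)

  unsquare : ∀ {u v k} → Walk (square Γ) u v k → ∃ λ l → l ≤ k + k × Walk Γ u v l
  unsquare [] = 0 , z≤n , []
  unsquare {k = suc k} ((_ , d , d≤2 , p , _) ∷ q) with unsquare q
  ... | l , l≤ , r = d + l
    , subst (d + l ≤_) (cong suc (sym (+-suc k k))) (+-mono-≤ d≤2 l≤)
    , concat p r

  -- For minimality, a walk of length `k` in the square expands to one of length at most `k + k`;
  -- hence `d ≤ k + k`, and halving gives the bound.
  square-isDistance : ∀ {u v d} → IsDistance Γ u v d → IsDistance (square Γ) u v ⌈ d /2⌉
  square-isDistance {d = d} g = square-geodesic (proj₁ g) g , λ {k} k<d q →
    let l , l≤ , r = unsquare q in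
    <⇒≱ k<d (subst (⌈ d /2⌉ ≤_) (sym (n≡⌈n+n/2⌉ k))
                   (⌈n/2⌉-mono (≤-trans (isDistance-≤ g r) l≤)))

  automorphism-walk : ∀ {π u v k} → IsAutomorphism Γ π → Walk Γ u v k →
                      Walk Γ (Inverse.to π u) (Inverse.to π v) k
  automorphism-walk         aut []      = []
  automorphism-walk {π = π} aut (e ∷ p) =
    Equivalence.to (aut _ _) e ∷ automorphism-walk {π = π} aut p

-- Hamming distance

infixl 6 _⊕_

_⊕_ : ∀ {n} → Vec Bool n → Vec Bool n → Vec Bool n
_⊕_ = zipWith _xor_

𝟎 𝟏 : ∀ {n} → Vec Bool n
𝟎 = replicate _ false
𝟏 = replicate _ true

⊕-self : ∀ {n} (u : Vec Bool n) → u ⊕ u ≡ 𝟎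
⊕-self []      = refl
⊕-self (b ∷ u) = cong₂ _∷_ (xor-same b) (⊕-self u)

⊕-comm : ∀ {n} (u v : Vec Bool n) → u ⊕ v ≡ v ⊕ u
⊕-comm = zipWith-comm xor-comm

⊕-assoc : ∀ {n} (u v w : Vec Bool n) → u ⊕ v ⊕ w ≡ u ⊕ (v ⊕ w)
⊕-assoc = zipWith-assoc xor-assoc

⊕-identityˡ : ∀ {n} (u : Vec Bool n) → 𝟎 ⊕ u ≡ u
⊕-identityˡ = zipWith-identityˡ λ _ → refl

⊕-identityʳ : ∀ {n} (u : Vec Bool n) → u ⊕ 𝟎 ≡ u
⊕-identityʳ = zipWith-identityʳ xor-identityʳ

⊕-cancel : ∀ {n} (u v : Vec Bool n) → u ⊕ v ⊕ v ≡ u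
⊕-cancel u v = trans (⊕-assoc u v v) (trans (cong (u ⊕_) (⊕-self v)) (⊕-identityʳ u))

⊕-translate : ∀ {n} (u v w : Vec Bool n) → (u ⊕ w) ⊕ (v ⊕ w) ≡ u ⊕ v
⊕-translate u v w = begin
  (u ⊕ w) ⊕ (v ⊕ w) ≡⟨ cong (u ⊕ w ⊕_) (⊕-comm v w) ⟩
  (u ⊕ w) ⊕ (w ⊕ v) ≡⟨ ⊕-assoc (u ⊕ w) w v ⟨
  u ⊕ w ⊕ w ⊕ v     ≡⟨ cong (_⊕ v) (⊕-cancel u w) ⟩
  u ⊕ v             ∎
  where open ≡-Reasoning

bit : Bool → ℕ
bit true  = 1
bit false = 0

weight : ∀ {n} → Vec Bool n → ℕ
weight []      = 0
weight (b ∷ u) = bit b + weight u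

weight-𝟎 : ∀ n → weight (𝟎 {n}) ≡ 0
weight-𝟎 zero    = refl
weight-𝟎 (suc n) = weight-𝟎 n

weight-𝟏 : ∀ n → weight (𝟏 {n}) ≡ n
weight-𝟏 zero    = refl
weight-𝟏 (suc n) = cong suc (weight-𝟏 n)

weight≤n : ∀ {n} (u : Vec Bool n) → weight u ≤ n
weight≤n []          = z≤n
weight≤n (true  ∷ u) = s≤s (weight≤n u)
weight≤n (false ∷ u) = m≤n⇒m≤1+n (weight≤n u)

weight≡n⇒𝟏 : ∀ {n} (u : Vec Bool n) → weight u ≡ n → u ≡ 𝟏
weight≡n⇒𝟏 []          _ = refl
weight≡n⇒𝟏 (true  ∷ u) e = cong (true ∷_) (weight≡n⇒𝟏 u (cong pred e))
weight≡n⇒𝟏 (false ∷ u) e = contradiction (weight≤n u) (<⇒≱ (≤-reflexive (sym e)))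

lookup-injective : ∀ {n} (u v : Vec Bool n) → (∀ i → lookup u i ≡ lookup v i) → u ≡ v
lookup-injective []      []      _ = refl
lookup-injective (b ∷ u) (c ∷ v) h = cong₂ _∷_ (h zero) (lookup-injective u v (h ∘ suc))

module _ {n : ℕ} where
  open Graph (Q n) using (_~_)
  open Graph (Q (suc n)) using () renaming (_~_ to _~⁺_)

  ~-cons : ∀ b {u v} → u ~ v → (b ∷ u) ~⁺ (b ∷ v)
  ~-cons b (i , d , unique) = suc i , d , λ
    { {zero}  d′ → contradiction refl d′
    ; {suc j} d′ → cong suc (unique d′) }

  ~-flip : ∀ {b c} u → b ≢ c → (b ∷ u) ~⁺ (c ∷ u)
  ~-flip u b≢c = zero , b≢c , λ
    { {zero}  _  → refl
    ; {suc j} d′ → contradiction refl d′ }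

  walk-cons : ∀ b {u v k} → Walk (Q n) u v k → Walk (Q (suc n)) (b ∷ u) (b ∷ v) k
  walk-cons b []      = []
  walk-cons b (e ∷ p) = ~-cons b e ∷ walk-cons b p

bit-triangle : ∀ a b c → bit (a xor c) ≤ suc (bit (b xor c))
bit-triangle true  _ true  = z≤n
bit-triangle true  _ false = s≤s z≤n
bit-triangle false _ true  = s≤s z≤n
bit-triangle false _ false = z≤n

hamming-step : ∀ {n} (u v w : Vec Bool n) → Graph._~_ (Q n) u v →
               weight (u ⊕ w) ≤ suc (weight (v ⊕ w))
hamming-step (a ∷ u) (b ∷ v) (c ∷ w) (zero , _ , unique)
  -- The differing position is the first, so a difference at `suc i` would contradict uniqueness:
  -- the tails coincide.
  with lookup-injective u v (λ i →
         decidable-stable (lookup u i ≟ᵇ lookup v i) (λ d → 0≢1+n (unique {suc i} d)))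
... | refl = +-monoˡ-≤ (weight (u ⊕ w)) (bit-triangle a b c)
hamming-step (a ∷ u) (b ∷ v) (c ∷ w) (suc i , d , unique)
  with a ≟ᵇ b
... | no a≢b with () ← unique {zero} a≢b
... | yes refl = subst (bit (a xor c) + weight (u ⊕ w) ≤_)
  (+-suc (bit (a xor c)) _)
  (+-monoʳ-≤ (bit (a xor c))
    (hamming-step u v w (i , d , λ d′ → suc-injective (unique d′))))

hamming-lower : ∀ {n} {u v : Vec Bool n} {k} → Walk (Q n) u v k → weight (u ⊕ v) ≤ k
hamming-lower {n} {u} [] = ≤-reflexive (trans (cong weight (⊕-self u)) (weight-𝟎 n))
hamming-lower {u = u} (_∷_ {v = w} e p) =
  ≤-trans (hamming-step u w _ e) (s≤s (hamming-lower p))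

hamming-walk : ∀ {n} (u v : Vec Bool n) → Walk (Q n) u v (weight (u ⊕ v))
hamming-walk []          []          = []
hamming-walk (true  ∷ u) (true  ∷ v) = walk-cons true (hamming-walk u v)
hamming-walk (false ∷ u) (false ∷ v) = walk-cons false (hamming-walk u v)
hamming-walk (true  ∷ u) (false ∷ v) =
  ~-flip u (λ ()) ∷ walk-cons false (hamming-walk u v)
hamming-walk (false ∷ u) (true  ∷ v) =
  ~-flip u (λ ()) ∷ walk-cons true (hamming-walk u v)

hamming-isDistance : ∀ {n} (u v : Vec Bool n) → IsDistance (Q n) u v (weight (u ⊕ v))
hamming-isDistance u v =
  hamming-walk u v , λ k<d p → <⇒≱ k<d (hamming-lower p)

δ : ∀ {n} → Vec Bool n → Vec Bool n → ℕ
δ u v = ⌈ weight (u ⊕ v) /2⌉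

δ-isDistance : ∀ {n} (u v : Vec Bool n) → IsDistance (square (Q n)) u v (δ u v)
δ-isDistance u v = square-isDistance (hamming-isDistance u v)

δ-self : ∀ {n} (u : Vec Bool n) → δ u u ≡ 0
δ-self u = isDistance-unique (δ-isDistance u u) ([] , λ ())

δ-sym : ∀ {n} (u v : Vec Bool n) → δ u v ≡ δ v u
δ-sym u v = cong (⌈_/2⌉ ∘ weight) (⊕-comm u v)

δ≡0⇒≡ : ∀ {n} (u v : Vec Bool n) → δ u v ≡ 0 → u ≡ v
δ≡0⇒≡ u v e with [] ← subst (Walk _ u v) e (proj₁ (δ-isDistance u v)) = refl

δ≡1⇒~ : ∀ {n} (u v : Vec Bool n) → δ u v ≡ 1 → Graph._~_ (square (Q n)) u v
δ≡1⇒~ u v e with e′ ∷ [] ← subst (Walk _ u v) e (proj₁ (δ-isDistance u v)) = e′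

~⇒δ≡1 : ∀ {n} (u v : Vec Bool n) → Graph._~_ (square (Q n)) u v → δ u v ≡ 1
~⇒δ≡1 u v e = isDistance-unique (δ-isDistance u v)
  (e ∷ [] , λ { (s≤s z≤n) [] → proj₁ e refl })

-- Coordinate permutations of the (n+1)-cube

-- Words in the adjacent transpositions rather than bijections of positions, so that compatibility
-- with sums, weight and parity follows by induction on the word.
data Perm : ℕ → Set where
  one  : ∀ {n} → Perm n
  keep : ∀ {n} → Perm n → Perm (suc n)
  swap : ∀ {n} → Perm (suc (suc n))
  _⨾_  : ∀ {n} → Perm n → Perm n → Perm n

act : ∀ {n} → Perm n → Vec Bool n → Vec Bool n
act one      u           = u
act (keep p) (b ∷ u)     = b ∷ act p u
act swap     (b ∷ c ∷ u) = c ∷ b ∷ u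
act (p ⨾ q)  u           = act q (act p u)

inv : ∀ {n} → Perm n → Perm n
inv one      = one
inv (keep p) = keep (inv p)
inv swap     = swap
inv (p ⨾ q)  = inv q ⨾ inv p

act-invˡ : ∀ {n} (p : Perm n) u → act (inv p) (act p u) ≡ u
act-invˡ one      u           = refl
act-invˡ (keep p) (b ∷ u)     = cong (b ∷_) (act-invˡ p u)
act-invˡ swap     (b ∷ c ∷ u) = refl
act-invˡ (p ⨾ q)  u = trans (cong (act (inv p)) (act-invˡ q (act p u))) (act-invˡ p u)

act-invʳ : ∀ {n} (p : Perm n) u → act p (act (inv p) u) ≡ u
act-invʳ one      u           = refl
act-invʳ (keep p) (b ∷ u)     = cong (b ∷_) (act-invʳ p u)
act-invʳ swap     (b ∷ c ∷ u) = refl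
act-invʳ (p ⨾ q)  u = trans (cong (act q) (act-invʳ p (act (inv q) u))) (act-invʳ q u)

act-⊕ : ∀ {n} (p : Perm n) u v → act p (u ⊕ v) ≡ act p u ⊕ act p v
act-⊕ one      u           v           = refl
act-⊕ (keep p) (b ∷ u)     (c ∷ v)     = cong ((b xor c) ∷_) (act-⊕ p u v)
act-⊕ swap     (_ ∷ _ ∷ _) (_ ∷ _ ∷ _) = refl
act-⊕ (p ⨾ q)  u           v           =
  trans (cong (act q) (act-⊕ p u v)) (act-⊕ q (act p u) (act p v))

weight-act : ∀ {n} (p : Perm n) u → weight (act p u) ≡ weight u
weight-act one      u           = refl
weight-act (keep p) (b ∷ u)     = cong (bit b +_) (weight-act p u)
weight-act swap     (b ∷ c ∷ u) = begin
  bit c + (bit b + weight u) ≡⟨ +-assoc (bit c) (bit b) _ ⟨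
  bit c + bit b + weight u   ≡⟨ cong (_+ weight u) (+-comm (bit c) (bit b)) ⟩
  bit b + bit c + weight u   ≡⟨ +-assoc (bit b) (bit c) _ ⟩
  bit b + (bit c + weight u) ∎
  where open ≡-Reasoning
weight-act (p ⨾ q)  u           = trans (weight-act q (act p u)) (weight-act p u)

-- true ^ k ++ false ^ (n ∸ k), for k ≤ n
sorted : ∀ n → ℕ → Vec Bool n
sorted n       zero    = 𝟎
sorted zero    (suc k) = []
sorted (suc n) (suc k) = true ∷ sorted n k

weight-sorted : ∀ {n k} → k ≤ n → weight (sorted n k) ≡ k
weight-sorted {n} z≤n       = weight-𝟎 n
weight-sorted     (s≤s k≤n) = cong suc (weight-sorted k≤n)

-- The insertion step of `sort`: the leading `false` moves past the `true` entries, one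
-- transposition at a time.
sink : ∀ {n k} → k ≤ n → ∃ λ p → act p (false ∷ sorted n k) ≡ sorted (suc n) k
sink z≤n       = one , refl
sink (s≤s k≤n) = let p , e = sink k≤n in swap ⨾ keep p , cong (true ∷_) e

sort : ∀ {n} (u : Vec Bool n) → ∃ λ p → act p u ≡ sorted n (weight u)
sort []          = one , refl
sort (true  ∷ u) = let p , e = sort u in keep p , cong (true ∷_) e
sort (false ∷ u) =
  let p , e = sort u
      q , f = sink (weight≤n u)
  in keep p ⨾ q , trans (cong (act q ∘ (false ∷_)) e) f

-- Words of equal weight have the same sorted form: `u` is sorted, then the sorting of `v` is
-- undone.
permute : ∀ {n} {u v : Vec Bool n} → weight u ≡ weight v → ∃ λ p → act p u ≡ v
permute {n} {u} {v} e =
  let p , p-eq = sort u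
      q , q-eq = sort v
  in p ⨾ inv q , (begin
    act (inv q) (act p u)               ≡⟨ cong (act (inv q)) p-eq ⟩
    act (inv q) (sorted n (weight u))   ≡⟨ cong (act (inv q) ∘ sorted n) e ⟩
    act (inv q) (sorted n (weight v))   ≡⟨ cong (act (inv q)) q-eq ⟨
    act (inv q) (act q v)               ≡⟨ act-invˡ q v ⟩
    v                                   ∎)
  where open ≡-Reasoning

-- The parity extension into the halved (n+1)-cube

parity : ∀ {n} → Vec Bool n → Bool
parity []      = false
parity (b ∷ u) = b xor parity u

xor-swap : ∀ a b c → a xor (b xor c) ≡ b xor (a xor c)
xor-swap a b c = begin
  a xor (b xor c) ≡⟨ xor-assoc a b c ⟨
  (a xor b) xor c ≡⟨ cong (_xor c) (xor-comm a b) ⟩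
  (b xor a) xor c ≡⟨ xor-assoc b a c ⟩
  b xor (a xor c) ∎
  where open ≡-Reasoning

parity-⊕ : ∀ {n} (u v : Vec Bool n) → parity (u ⊕ v) ≡ parity u xor parity v
parity-⊕ []      []      = refl
parity-⊕ (b ∷ u) (c ∷ v) = begin
  (b xor c) xor parity (u ⊕ v)          ≡⟨ cong ((b xor c) xor_) (parity-⊕ u v) ⟩
  (b xor c) xor (parity u xor parity v) ≡⟨ xor-assoc b c _ ⟩
  b xor (c xor (parity u xor parity v)) ≡⟨ cong (b xor_) (xor-swap c (parity u) _) ⟩
  b xor (parity u xor (c xor parity v)) ≡⟨ xor-assoc b (parity u) _ ⟨
  (b xor parity u) xor (c xor parity v) ∎
  where open ≡-Reasoning

parity-act : ∀ {n} (p : Perm n) u → parity (act p u) ≡ parity u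
parity-act one      u           = refl
parity-act (keep p) (b ∷ u)     = cong (b xor_) (parity-act p u)
parity-act swap     (b ∷ c ∷ u) = xor-swap c b (parity u)
parity-act (p ⨾ q)  u           = trans (parity-act q (act p u)) (parity-act p u)

-- Identifies the `n`-cube with the even-weight words of length `n + 1`, the vertices of the halved
-- cube; `tail` is the inverse.
ext : ∀ {n} → Vec Bool n → Vec Bool (suc n)
ext u = parity u ∷ u

ext-⊕ : ∀ {n} (u v : Vec Bool n) → ext (u ⊕ v) ≡ ext u ⊕ ext v
ext-⊕ u v = cong (_∷ u ⊕ v) (parity-⊕ u v)

parity-ext : ∀ {n} (u : Vec Bool n) → parity (ext u) ≡ false
parity-ext u = xor-same (parity u)

ext-tail : ∀ {n} (u : Vec Bool (suc n)) → parity u ≡ false → ext (tail u) ≡ u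
ext-tail (b ∷ u) e = cong (_∷ u) (begin
  parity u                   ≡⟨ cong (_xor parity u) (xor-same b) ⟨
  (b xor b) xor parity u     ≡⟨ xor-assoc b b _ ⟩
  b xor (b xor parity u)     ≡⟨ cong (b xor_) e ⟩
  b xor false                ≡⟨ xor-identityʳ b ⟩
  b                          ∎)
  where open ≡-Reasoning

mutual
  -- The parity bit rounds the weight up to an even number, and the complementary bit in
  -- `weight-coext` makes it odd. A leading `true` flips the parity, hence the mutual recursion.
  weight-ext : ∀ {n} (u : Vec Bool n) → weight (ext u) ≡ ⌈ weight u /2⌉ + ⌈ weight u /2⌉
  weight-ext []          = refl
  weight-ext (false ∷ u) = weight-ext u
  weight-ext (true  ∷ u) = begin
    bit (not (parity u)) + suc (weight u) ≡⟨ +-suc (bit (not (parity u))) _ ⟩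
    suc (weight (not (parity u) ∷ u))     ≡⟨ cong suc (weight-coext u) ⟩
    suc (suc (h + h))                     ≡⟨ cong suc (+-suc h h) ⟨
    suc h + suc h                         ∎
    where
    open ≡-Reasoning
    h = ⌊ weight u /2⌋

  weight-coext : ∀ {n} (u : Vec Bool n) →
                 weight (not (parity u) ∷ u) ≡ suc (⌊ weight u /2⌋ + ⌊ weight u /2⌋)
  weight-coext []          = refl
  weight-coext (false ∷ u) = weight-coext u
  weight-coext (true  ∷ u) = begin
    bit (not (not (parity u))) + suc (weight u)
      ≡⟨ cong (λ b → bit b + suc (weight u)) (not-involutive (parity u)) ⟩
    bit (parity u) + suc (weight u)       ≡⟨ +-suc (bit (parity u)) _ ⟩
    suc (weight (ext u))                  ≡⟨ cong suc (weight-ext u) ⟩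
    suc (⌈ weight u /2⌉ + ⌈ weight u /2⌉) ∎
    where open ≡-Reasoning

-- A permutation of all `n + 1` coordinates, transported along `ext`. If `p` moves the parity
-- coordinate, this is in general not an automorphism of the `n`-cube, only of its square.
lift : ∀ {n} → Perm (suc n) → Vec Bool n → Vec Bool n
lift p u = tail (act p (ext u))

-- Permutations preserve the parity `false` of `ext u`, so `ext` recovers the bit that `tail` drops.
ext-lift : ∀ {n} (p : Perm (suc n)) u → ext (lift p u) ≡ act p (ext u)
ext-lift p u = ext-tail (act p (ext u)) (trans (parity-act p (ext u)) (parity-ext u))

lift-invˡ : ∀ {n} (p : Perm (suc n)) u → lift (inv p) (lift p u) ≡ u
lift-invˡ p u =
  cong tail (trans (cong (act (inv p)) (ext-lift p u)) (act-invˡ p (ext u)))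

lift-invʳ : ∀ {n} (p : Perm (suc n)) u → lift p (lift (inv p) u) ≡ u
lift-invʳ p u =
  cong tail (trans (cong (act p) (ext-lift (inv p) u)) (act-invʳ p (ext u)))

tail-⊕ : ∀ {n} (u v : Vec Bool (suc n)) → tail (u ⊕ v) ≡ tail u ⊕ tail v
tail-⊕ (_ ∷ _) (_ ∷ _) = refl

lift-⊕ : ∀ {n} (p : Perm (suc n)) u v → lift p (u ⊕ v) ≡ lift p u ⊕ lift p v
lift-⊕ p u v = begin
  tail (act p (ext (u ⊕ v)))             ≡⟨ cong (tail ∘ act p) (ext-⊕ u v) ⟩
  tail (act p (ext u ⊕ ext v))           ≡⟨ cong tail (act-⊕ p (ext u) (ext v)) ⟩
  tail (act p (ext u) ⊕ act p (ext v))   ≡⟨ tail-⊕ (act p (ext u)) (act p (ext v)) ⟩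
  lift p u ⊕ lift p v                    ∎
  where open ≡-Reasoning

-- The rounded half weight is exactly half the weight of the extension, which permutations preserve.
half-weight-lift : ∀ {n} (p : Perm (suc n)) u → ⌈ weight (lift p u) /2⌉ ≡ ⌈ weight u /2⌉
half-weight-lift p u = begin
  h                        ≡⟨ n≡⌊n+n/2⌋ h ⟩
  ⌊ h + h /2⌋              ≡⟨ cong ⌊_/2⌋ (weight-ext (lift p u)) ⟨
  ⌊ weight (ext (lift p u)) /2⌋ ≡⟨ cong (⌊_/2⌋ ∘ weight) (ext-lift p u) ⟩
  ⌊ weight (act p (ext u)) /2⌋ ≡⟨ cong ⌊_/2⌋ (weight-act p (ext u)) ⟩
  ⌊ weight (ext u) /2⌋     ≡⟨ cong ⌊_/2⌋ (weight-ext u) ⟩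
  ⌊ k + k /2⌋              ≡⟨ n≡⌊n+n/2⌋ k ⟨
  k                        ∎
  where
  open ≡-Reasoning
  h = ⌈ weight (lift p u) /2⌉
  k = ⌈ weight u /2⌉

-- Automorphisms of the square of the n-cube

module _ {n : ℕ} where

  δ-preserving : (π : Vec Bool n ↔ Vec Bool n) →
    (∀ u v → δ (Inverse.to π u) (Inverse.to π v) ≡ δ u v) → IsAutomorphism (square (Q n)) π
  δ-preserving π h u v = mk⇔
    (λ e → δ≡1⇒~ _ _ (trans (h u v) (~⇒δ≡1 u v e)))
    (λ e → δ≡1⇒~ u v (trans (sym (h u v)) (~⇒δ≡1 _ _ e)))

  automorphism-δ-≤ : ∀ π → IsAutomorphism (square (Q n)) π →
    ∀ u v → δ (Inverse.to π u) (Inverse.to π v) ≤ δ u v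
  automorphism-δ-≤ π aut u v = isDistance-≤ (δ-isDistance _ _)
    (automorphism-walk {π = π} aut (proj₁ (δ-isDistance u v)))

  automorphism-δ : ∀ π → IsAutomorphism (square (Q n)) π →
    ∀ u v → δ (Inverse.to π u) (Inverse.to π v) ≡ δ u v
  automorphism-δ π aut u v = ≤-antisym (automorphism-δ-≤ π aut u v)
    (subst₂ (λ u′ v′ → δ u′ v′ ≤ δ (to u) (to v)) (strictlyInverseʳ u) (strictlyInverseʳ v)
      (automorphism-δ-≤ (↔-sym π)
        (PermutationGroup.⁻¹-closed (Aut (square (Q n))) {π} aut) (to u) (to v)))
    where open Inverse π

  -- Translate `u` to `𝟎`, apply the additive map `lift p`, translate `𝟎` to `x`. So `u` goes to `x`
  -- whatever `p` is, and `p` can be chosen to place a second vertex.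
  motion : Perm (suc n) → Vec Bool n → Vec Bool n → Vec Bool n ↔ Vec Bool n
  motion p u x = mk↔ₛ′
    (λ z → lift p (z ⊕ u) ⊕ x)
    (λ z → lift (inv p) (z ⊕ x) ⊕ u)
    (λ z → trans (cong (λ y → lift p y ⊕ x) (⊕-cancel _ u))
             (trans (cong (_⊕ x) (lift-invʳ p (z ⊕ x))) (⊕-cancel z x)))
    (λ z → trans (cong (λ y → lift (inv p) y ⊕ u) (⊕-cancel _ x))
             (trans (cong (_⊕ u) (lift-invˡ p (z ⊕ u))) (⊕-cancel z u)))

  motion-automorphism : ∀ p u x → IsAutomorphism (square (Q n)) (motion p u x)
  motion-automorphism p u x = δ-preserving (motion p u x) λ y z → begin
    ⌈ weight ((lift p (y ⊕ u) ⊕ x) ⊕ (lift p (z ⊕ u) ⊕ x)) /2⌉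
      ≡⟨ cong half (⊕-translate (lift p (y ⊕ u)) (lift p (z ⊕ u)) x) ⟩
    ⌈ weight (lift p (y ⊕ u) ⊕ lift p (z ⊕ u)) /2⌉
      ≡⟨ cong half (lift-⊕ p (y ⊕ u) (z ⊕ u)) ⟨
    ⌈ weight (lift p ((y ⊕ u) ⊕ (z ⊕ u))) /2⌉
      ≡⟨ cong (half ∘ lift p) (⊕-translate y z u) ⟩
    ⌈ weight (lift p (y ⊕ z)) /2⌉
      ≡⟨ half-weight-lift p (y ⊕ z) ⟩
    ⌈ weight (y ⊕ z) /2⌉ ∎
    where
    open ≡-Reasoning
    half : Vec Bool n → ℕ
    half = ⌈_/2⌉ ∘ weight

  -- The weights of `v ⊕ u` and `y ⊕ x` may differ, as 1 and 2 do, but both extensions have twice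
  -- the common distance as weight, so a permutation of the `n + 1` coordinates carries one to the
  -- other.
  pair-transitive : ∀ (u v x y : Vec Bool n) → δ u v ≡ δ x y →
    ∃ λ π → IsAutomorphism (square (Q n)) π × Inverse.to π u ≡ x × Inverse.to π v ≡ y
  pair-transitive u v x y e = motion p u x , motion-automorphism p u x , u↦x , v↦y
    where
    open ≡-Reasoning
    ext-weights : weight (ext (v ⊕ u)) ≡ weight (ext (y ⊕ x))
    ext-weights = begin
      weight (ext (v ⊕ u)) ≡⟨ weight-ext (v ⊕ u) ⟩
      δ v u + δ v u        ≡⟨ cong (λ k → k + k) (trans (δ-sym v u) (trans e (δ-sym x y))) ⟩
      δ y x + δ y x        ≡⟨ weight-ext (y ⊕ x) ⟨
      weight (ext (y ⊕ x)) ∎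
    ext-permutation = permute {u = ext (v ⊕ u)} {ext (y ⊕ x)} ext-weights
    p = proj₁ ext-permutation
    u↦x : lift p (u ⊕ u) ⊕ x ≡ x
    u↦x = begin
      lift p (u ⊕ u) ⊕ x        ≡⟨ cong (_⊕ x) (lift-⊕ p u u) ⟩
      lift p u ⊕ lift p u ⊕ x   ≡⟨ cong (_⊕ x) (⊕-self (lift p u)) ⟩
      𝟎 ⊕ x                     ≡⟨ ⊕-identityˡ x ⟩
      x                         ∎
    v↦y : lift p (v ⊕ u) ⊕ x ≡ y
    v↦y = begin
      lift p (v ⊕ u) ⊕ x        ≡⟨ cong ((_⊕ x) ∘ tail) (proj₂ ext-permutation) ⟩
      y ⊕ x ⊕ x                 ≡⟨ ⊕-cancel y x ⟩
      y                         ∎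

  square-distanceTransitive : DistanceTransitive (square (Q n))
  square-distanceTransitive u v x y same = pair-transitive u v x y
    (isDistance-unique (Equivalence.to (same (δ u v)) (δ-isDistance u v)) (δ-isDistance x y))

  square-transitive : IsTransitive (Aut (square (Q n)))
  square-transitive x y =
    let π , aut , x↦y , _ = pair-transitive x x y y (trans (δ-self x) (sym (δ-self y)))
    in π , aut , x↦y

-- Blocks

module _ {X : Set} (G : PermutationGroup X) where
  open PermutationGroup G

  block-stable : ∀ B → IsBlock G B → ∀ g → Member g → ∀ {x y} →
    T (B x) → T (B (Inverse.to g x)) → T (B y) → T (B (Inverse.to g y))
  -- The block condition is applied to the inverse of `g`. The intersection contains `x`, so each
  -- `y` in `B` is the preimage under `g` of some `z` in `B`, and its image `z` lies in `B`.
  block-stable B block g g∈G {x} x∈B gx∈B y∈B with block (↔-sym g) (⁻¹-closed g∈G)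
  ... | inj₂ empty = ⊥-elim (empty x (x∈B , -, gx∈B , Inverse.strictlyInverseʳ g x))
  ... | inj₁ (_ , B⊆) with _ , z , z∈B , refl ← B⊆ y∈B =
    subst (T ∘ B) (sym (Inverse.strictlyInverseˡ g z)) z∈B

  module _ (R : X → X → Set) (R? : ∀ x y → Dec (R x y))
           (R-sym : ∀ {x y} → R x y → R y x)
           (R-trans : ∀ {x y z} → R x y → R y z → R x z)
           (R-invariant : ∀ g → Member g → ∀ {x y} →
             R x y → R (Inverse.to g x) (Inverse.to g y)) where

    class : X → Subset X
    class a x = isYes (R? a x)

    -- If `R a (g a)` holds, applying the inverse of `g` shows that each element of the class is the
    -- image of another one in it. Otherwise a common element `g x` would link `a` to `g a`.
    class-block : ∀ a → IsBlock G (class a)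
    class-block a g g∈G with R? a (Inverse.to g a)
    ... | yes a~ga = inj₁ (proj₁ , λ {y} y∈ → y∈ , from y ,
            fromWitness (subst (λ z → R z (from y)) (strictlyInverseʳ a)
              (R-invariant (↔-sym g) (⁻¹-closed g∈G)
                (R-trans (R-sym a~ga) (toWitness y∈)))) ,
            strictlyInverseˡ y)
      where open Inverse g
    ... | no a≁ga = inj₂ λ { y (y∈ , x , x∈ , refl) →
            a≁ga (R-trans (toWitness y∈) (R-sym (R-invariant g g∈G (toWitness x∈)))) }

module _ {X : Set} (B : Subset X) where

  Elements-≡ : ∀ {a b : Elements B} → proj₁ a ≡ proj₁ b → a ≡ b
  Elements-≡ {x , p} {_ , q} refl = cong (x ,_) (T-irrelevant p q)

  empty-trivial : (∀ x → ¬ T (B x)) → IsTrivial B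
  empty-trivial empty = inj₁ (mk↔ₛ′
    (λ (x , p) → ⊥-elim (empty x p)) (λ ()) (λ ()) (λ (x , p) → ⊥-elim (empty x p)))

  singleton-trivial : ∀ {a} → T (B a) → (∀ x → T (B x) → a ≡ x) → IsTrivial B
  singleton-trivial p unique = inj₂ (inj₁ (mk↔ₛ′
    (λ _ → zero) (λ _ → -, p) (λ { zero → refl }) (λ (x , q) → Elements-≡ (unique x q))))

  full-trivial : (∀ x → T (B x)) → IsTrivial B
  full-trivial full = inj₂ (inj₂ (mk↔ₛ′
    proj₁ (λ x → x , full x) (λ _ → refl) (λ _ → Elements-≡ refl)))

  -- `B` has an element besides `a`, and by the fourth hypothesis only one, so it has too many
  -- elements for `Fin 0` and `Fin 1`, and too few for the three distinct `c`, `d`, `e`.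
  pair-nontrivial : ∀ {a b} → T (B a) → T (B b) → a ≢ b →
    (∀ {x y} → x ≢ a → y ≢ a → T (B x) → T (B y) → x ≡ y) →
    (∀ x → Dec (x ≡ a)) →
    {c d e : X} → c ≢ d → c ≢ e → d ≢ e → ¬ IsTrivial B
  pair-nontrivial a∈B _ _ _ _ _ _ _ (inj₁ f) with () ← Inverse.to f (-, a∈B)
  pair-nontrivial a∈B b∈B a≢b _ _ _ _ _ (inj₂ (inj₁ f)) =
    a≢b (cong proj₁ (Injection.injective (Inverse⇒Injection f) (fin₁ (to (-, a∈B)) (to (-, b∈B)))))
    where
    open Inverse f using (to)
    fin₁ : (i j : Fin 1) → i ≡ j
    fin₁ zero zero = refl
  pair-nontrivial {a} a∈B _ _ merge _≟a {c} {d} {e} c≢d c≢e d≢e (inj₂ (inj₂ f)) =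
    -- Pigeonhole: of three elements of `B`, two are both equal to `a` or both different from it.
    cases (elt c ≟a) (elt d ≟a) (elt e ≟a)
    where
    open Injection (Inverse⇒Injection (↔-sym f)) using (to; injective)
    elt : X → X
    elt x = proj₁ (to x)
    both : ∀ {x y} → elt x ≡ a → elt y ≡ a → x ≡ y
    both p q = injective (Elements-≡ (trans p (sym q)))
    neither : ∀ {x y} → elt x ≢ a → elt y ≢ a → x ≡ y
    neither {x} {y} p q = injective (Elements-≡ (merge p q (proj₂ (to x)) (proj₂ (to y))))
    cases : Dec (elt c ≡ a) → Dec (elt d ≡ a) → Dec (elt e ≡ a) → ⊥
    cases (yes p) (yes q) _       = c≢d (both p q)
    cases (yes p) (no _)  (yes r) = c≢e (both p r)
    cases (yes _) (no q)  (no r)  = d≢e (neither q r)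
    cases (no p)  (no q)  _       = c≢d (neither p q)
    cases (no p)  (yes _) (no r)  = c≢e (neither p r)
    cases (no _)  (yes q) (yes r) = d≢e (both q r)

-- Even dimension

-- Rounding `k` up to an even number cannot pass the even number `n`. For odd `n` this fails at
-- `k = n`.
double-half≤ : ∀ {n k} → 2 ∣ n → k ≤ n → ⌈ k /2⌉ + ⌈ k /2⌉ ≤ n
double-half≤ {k = k} (divides q refl) k≤n = subst (⌈ k /2⌉ + ⌈ k /2⌉ ≤_) q+q≡
  (+-mono-≤ half≤q half≤q)
  where
  q+q≡ : q + q ≡ q * 2
  q+q≡ = trans (cong (q +_) (sym (+-identityʳ q))) (*-comm 2 q)
  half≤q : ⌈ k /2⌉ ≤ q
  half≤q = subst (⌈ k /2⌉ ≤_)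
    (trans (cong ⌈_/2⌉ (sym q+q≡)) (sym (n≡⌈n+n/2⌉ q))) (⌈n/2⌉-mono k≤n)

-- Weights `2k + 1` and `2k + 2` both round to distance `suc k`. So one word `w` of weight `2k + 1`,
-- prefixed by either bit and translated by `u`, gives two neighbours on the same sphere; the
-- hypothesis is that `w` fits into `n` coordinates.
adjacent-pair : ∀ {n} (u : Vec Bool (suc n)) k → suc k + suc k ≤ suc n →
  ∃ λ v₀ → ∃ λ v₁ → δ u v₀ ≡ suc k × δ u v₁ ≡ suc k × δ v₀ v₁ ≡ 1
adjacent-pair {n} u k (s≤s 2k+1≤n) =
  (false ∷ w) ⊕ u , (true ∷ w) ⊕ u
  , trans (from-u false) (trans (cong ⌈_/2⌉ weight-w) (sym (n≡⌊n+n/2⌋ (suc k))))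
  , trans (from-u true) (trans (cong (⌈_/2⌉ ∘ suc) weight-w) (sym (n≡⌈n+n/2⌉ (suc k))))
  , trans (cong half (⊕-translate (false ∷ w) (true ∷ w) u))
      (cong (⌈_/2⌉ ∘ suc) (trans (cong weight (⊕-self w)) (weight-𝟎 n)))
  where
  half : Vec Bool (suc n) → ℕ
  half = ⌈_/2⌉ ∘ weight
  w = sorted n (k + suc k)
  weight-w : weight w ≡ k + suc k
  weight-w = weight-sorted 2k+1≤n
  from-u : ∀ b → δ u ((b ∷ w) ⊕ u) ≡ half (b ∷ w)
  from-u b = trans (δ-sym u _) (cong half (⊕-cancel (b ∷ w) u))

-- Some automorphism takes `u` to `x` and `v` to `y`. It keeps `u` inside `B`, so it keeps `v` there
-- too.
block-spheres : ∀ {n} B → IsBlock (Aut (square (Q n))) B → ∀ {u v} → T (B u) → T (B v) →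
  ∀ x y → δ u v ≡ δ x y → T (B x) → T (B y)
block-spheres B block {u} {v} u∈B v∈B x y e x∈B
  with π , aut , refl , refl ← pair-transitive u v x y e =
  block-stable (Aut (square (Q _))) B block π aut u∈B x∈B v∈B

even-block-full : ∀ {n} → 2 ∣ suc n → ∀ B → IsBlock (Aut (square (Q (suc n)))) B →
  ∀ {u v} → u ≢ v → T (B u) → T (B v) → ∀ x → T (B x)
even-block-full {n} even B block {u} {v} u≢v u∈B v∈B x
  with δ u v in eq | double-half≤ even (weight≤n (u ⊕ v))
... | zero  | _ = contradiction (δ≡0⇒≡ u v eq) u≢v
... | suc k | 2k≤n
  with v₀ , v₁ , e₀ , e₁ , e ← adjacent-pair u k 2k≤n =
  -- The square is connected, and a walk from `u` to `x` cannot leave `B`: the pair `v₀`, `v₁` makes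
  -- `B` closed under steps of distance one.
  along (proj₁ (δ-isDistance u x)) u∈B
  where
  v₀∈B = block-spheres B block u∈B v∈B u v₀ (trans eq (sym e₀)) u∈B
  v₁∈B = block-spheres B block u∈B v∈B u v₁ (trans eq (sym e₁)) u∈B
  along : ∀ {y z l} → Walk (square (Q (suc n))) y z l → T (B y) → T (B z)
  along []      y∈B = y∈B
  along (f ∷ p) y∈B = along p
    (block-spheres B block v₀∈B v₁∈B _ _ (trans e (sym (~⇒δ≡1 _ _ f))) y∈B)

even-primitive : ∀ {n} → 2 ∣ suc n → Primitive (square (Q (suc n)))
even-primitive {n} even = square-transitive , trivial
  where
  Γ = square (Q (suc n))
  trivial : ∀ B → IsBlock (Aut Γ) B → IsTrivial B
  trivial B block with anyVertex? Γ (λ x → T? (B x))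
  ... | no none = empty-trivial B λ x x∈B → none (x , x∈B)
  ... | yes (u , u∈B) with anyVertex? Γ (λ x → T? (B x) ×-dec ¬? (_≟ⱽ_ Γ u x))
  ...   | no unique = singleton-trivial B u∈B λ x x∈B →
            decidable-stable (_≟ⱽ_ Γ u x) λ u≢x → unique (x , x∈B , u≢x)
  ...   | yes (v , v∈B , u≢v) =
            full-trivial B (even-block-full even B block u≢v u∈B v∈B)

-- Odd dimension

odd-half-injective : ∀ {n k} → Odd n → k ≤ n → ⌈ k /2⌉ ≡ ⌈ n /2⌉ → k ≡ n
odd-half-injective {n} {k} odd k≤n e with m≤n⇒m<n∨m≡n k≤n
... | inj₂ k≡n = k≡n
... | inj₁ k<n = contradiction
  (divides ⌊ n /2⌋ (begin
    n                       ≡⟨ ⌊n/2⌋+⌈n/2⌉≡n n ⟨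
    ⌊ n /2⌋ + ⌈ n /2⌉       ≡⟨ cong (⌊ n /2⌋ +_) halves ⟨
    ⌊ n /2⌋ + ⌊ n /2⌋       ≡⟨ cong (⌊ n /2⌋ +_) (+-identityʳ ⌊ n /2⌋) ⟨
    2 * ⌊ n /2⌋             ≡⟨ *-comm 2 ⌊ n /2⌋ ⟩
    ⌊ n /2⌋ * 2             ∎))
  odd
  where
  open ≡-Reasoning
  halves : ⌊ n /2⌋ ≡ ⌈ n /2⌉
  -- `⌈ k /2⌉` is by definition `⌊ suc k /2⌋`, so `k < n` bounds it by `⌊ n /2⌋`. The two halves of
  -- `n` then agree and `n` is even.
  halves = ≤-antisym (⌊n/2⌋≤⌈n/2⌉ n) (subst (_≤ ⌊ n /2⌋) e (⌊n/2⌋-mono k<n))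

module _ {n : ℕ} where

  -- `⌈ n /2⌉` is the largest value of `δ`, attained by complementary words.
  Antipodal : Vec Bool n → Vec Bool n → Set
  Antipodal u v = δ u v ≡ ⌈ n /2⌉

  -- For odd `n` the maximal distance forces weight `n`, so the complement of `v` is its only
  -- antipode.
  antipode-unique : Odd n → ∀ {u v w} → Antipodal u v → Antipodal v w → u ≡ w
  antipode-unique odd {u} {v} {w} uv vw = begin
    u         ≡⟨ ⊕-cancel u v ⟨
    u ⊕ v ⊕ v ≡⟨ cong (_⊕ v) (trans (opposite uv) (sym (opposite (trans (δ-sym w v) vw)))) ⟩
    w ⊕ v ⊕ v ≡⟨ ⊕-cancel w v ⟩
    w         ∎
    where
    open ≡-Reasoning
    opposite : ∀ {x y} → Antipodal x y → x ⊕ y ≡ 𝟏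
    opposite {x} {y} e = weight≡n⇒𝟏 (x ⊕ y) (odd-half-injective odd (weight≤n (x ⊕ y)) e)

  EqualOrAntipodal : Vec Bool n → Vec Bool n → Set
  EqualOrAntipodal u v = u ≡ v ⊎ Antipodal u v

odd-imprimitive : ∀ {n} → 2 ≤ n → Odd n → Imprimitive (square (Q n))
odd-imprimitive {n@(suc (suc _))} (s≤s (s≤s z≤n)) odd = square-transitive , λ (_ , trivial) →
  pair-nontrivial (class G R R? R-sym R-trans R-invariant 𝟎)
    {𝟎} {𝟏} (fromWitness (inj₁ refl)) (fromWitness (inj₂ 𝟎-𝟏)) (λ ())
    (λ {x} {y} x≢𝟎 y≢𝟎 x∈ y∈ → antipode-unique odd {x} {𝟎} {y}
      (trans (δ-sym x 𝟎) (antipode x≢𝟎 (toWitness x∈))) (antipode y≢𝟎 (toWitness y∈)))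
    (λ x → ≡-dec _≟ᵇ_ x 𝟎)
    -- Three distinct vertices, available since `n ≥ 2`, against the two elements of the class of
    -- `𝟎`.
    {false ∷ false ∷ 𝟎} {false ∷ true ∷ 𝟎} {true ∷ false ∷ 𝟎} (λ ()) (λ ()) (λ ())
    (trivial _ (class-block G R R? R-sym R-trans R-invariant 𝟎))
  where
  G = Aut (square (Q n))
  R = EqualOrAntipodal {n}
  R? : ∀ x y → Dec (R x y)
  R? x y = ≡-dec _≟ᵇ_ x y ⊎-dec (δ x y ≟ ⌈ n /2⌉)
  R-sym : ∀ {x y} → R x y → R y x
  R-sym (inj₁ e)         = inj₁ (sym e)
  R-sym {x} {y} (inj₂ e) = inj₂ (trans (δ-sym y x) e)
  R-trans : ∀ {x y z} → R x y → R y z → R x z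
  R-trans (inj₁ refl) r           = r
  R-trans (inj₂ e)    (inj₁ refl) = inj₂ e
  -- Two antipodal steps return to the start because `n` is odd.
  R-trans (inj₂ e)    (inj₂ f)    = inj₁ (antipode-unique odd e f)
  R-invariant : ∀ g → PermutationGroup.Member G g → ∀ {x y} →
    R x y → R (Inverse.to g x) (Inverse.to g y)
  R-invariant g aut         (inj₁ e) = inj₁ (cong (Inverse.to g) e)
  R-invariant g aut {x} {y} (inj₂ e) = inj₂ (trans (automorphism-δ g aut x y) e)
  𝟎-𝟏 : Antipodal {n} 𝟎 𝟏
  𝟎-𝟏 = cong ⌈_/2⌉ (trans (cong weight (⊕-identityˡ (𝟏 {n}))) (weight-𝟏 n))
  antipode : ∀ {x} → x ≢ 𝟎 → R 𝟎 x → Antipodal 𝟎 x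
  antipode x≢𝟎 (inj₁ e) = contradiction (sym e) x≢𝟎
  antipode _   (inj₂ e) = e

corollary3p8 : (n : ℕ) → 4 ≤ n →
    (Imprimitive (square (Q n)) × DistanceTransitive (square (Q n))) ⇔ Odd n
corollary3p8 n@(suc _) 4≤n = mk⇔
  -- `Odd n` is a negation: evenness would make the square primitive.
  (λ ((_ , imprimitive) , _) even → imprimitive (even-primitive even))
  (λ odd → odd-imprimitive (≤-trans (s≤s (s≤s z≤n)) 4≤n) odd , square-distanceTransitive)
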